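{- Let $r\ge1$ and let $p_1,p_2,\ldots,p_r$ be primes, each $\ge5$ (not necessarily distinct). Then for every $n\ge0$, \[ b_2\!\left(\prod_{s=1}^{r}p_s^2\, n+\frac{(24i+p_{r})\prod_{s=1}^{r-1}p_s^2\,p_{r}-1}{24}\right)\equiv 0 \pmod 2 \] for each $i=1,2,\ldots,p_r-1$ (with the empty product equal to $1$).
   Context: For a positive integer $\ell$, $b_\ell(n)$ denotes the number of partitions of $n$ having no part divisible by $\ell$. -}

module Defs where

open import Data.Nat using (ℕ; zero; suc; _*_; _≥_; _>_; _≥?_; z≤n; s≤s)
open import Data.Nat.Properties using (suc-injective)
open import Data.Nat.Divisibility using (_∣_; _∣?_)
open import Data.List using (List; []; _∷_; length; map; concatMap; filter)
open import Data.Nat.ListAction using (sum)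
open import Data.List.Membership.Propositional using (_∈_; find; lose)
open import Data.List.Membership.Propositional.Properties
  using (∈-concatMap⁺; ∈-concatMap⁻; ∈-filter⁺; ∈-filter⁻)
open import Data.List.Relation.Unary.All as All using (All; []; _∷_)
open import Data.List.Relation.Unary.All.Properties using (map⁺)
open import Data.List.Relation.Unary.AllPairs using (AllPairs; []; _∷_)
open import Data.List.Relation.Unary.Any using (here; there)
open import Data.List.Relation.Unary.Linked using (Linked; linked?)
open import Data.List.Relation.Unary.Unique.Propositional using (Unique)
open import Data.List.Relation.Unary.Unique.Propositional.Properties
  using (concat⁺; filter⁺)
open import Data.List.Relation.Binary.Disjoint.Propositional using (Disjoint)
open import Data.Product using (_×_; _,_; proj₁)
open import Data.Vec.Functional using (Vector; foldr)
open import Function using (_∘_)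
open import Relation.Nullary using (¬_; Dec; ¬?)
open import Relation.Binary.PropositionalEquality
  using (_≡_; _≢_; refl; sym; trans)

IsComposition : ℕ → List ℕ → Set
IsComposition n xs = All (_> 0) xs × sum xs ≡ n

IsPartition : ℕ → List ℕ → Set
IsPartition n xs = IsComposition n xs × Linked _≥_ xs

-- A composition of suc n arises from a unique composition of n, by prepending
-- the part 1 or by incrementing the first part.
extend : List ℕ → List (List ℕ)
extend []       = (1 ∷ []) ∷ []
extend (x ∷ xs) = (1 ∷ x ∷ xs) ∷ (suc x ∷ xs) ∷ []

compositions : ℕ → List (List ℕ)
compositions zero    = [] ∷ []
compositions (suc n) = concatMap extend (compositions n)

partitions : ℕ → List (List ℕ)
partitions n = filter (linked? _≥?_) (compositions n)

Regular : ℕ → List ℕ → Set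
Regular ℓ = All (λ x → ¬ (ℓ ∣ x))

regular? : ∀ ℓ xs → Dec (Regular ℓ xs)
regular? ℓ = All.all? (λ x → ¬? (ℓ ∣? x))

b : ℕ → ℕ → ℕ
b ℓ n = length (filter (regular? ℓ) (partitions n))

∏ : ∀ {n} → Vector ℕ n → ℕ
∏ = foldr _*_ 1

-- partitions n lists every partition of n (partitions-sound,
-- partitions-complete) exactly once (partitions-unique), so b counts correctly.

extend-sound : ∀ {n} xs {ys} → IsComposition n xs → ys ∈ extend xs →
               IsComposition (suc n) ys
extend-sound []       (_        , refl) (here refl)         = s≤s z≤n ∷ [] , refl
extend-sound (x ∷ xs) (pos      , refl) (here refl)         = s≤s z≤n ∷ pos , refl
extend-sound (x ∷ xs) (_ ∷ pos  , refl) (there (here refl)) = s≤s z≤n ∷ pos , refl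

compositions-sound : ∀ n {xs} → xs ∈ compositions n → IsComposition n xs
compositions-sound zero    (here refl) = [] , refl
compositions-sound (suc n) xs∈ =
  let ys , ys∈ , xs∈ext = find (∈-concatMap⁻ extend xs∈)
  in  extend-sound ys (compositions-sound n ys∈) xs∈ext

compositions-complete : ∀ n xs → IsComposition n xs → xs ∈ compositions n
compositions-complete zero    []                 _                 = here refl
compositions-complete zero    (zero ∷ _)         (() ∷ _ , _)
compositions-complete (suc n) (zero ∷ _)         (() ∷ _ , _)
compositions-complete (suc n) (suc zero ∷ [])    (_ ∷ pos , eq)    =
  ∈-concatMap⁺ extend
    (lose (compositions-complete n [] (pos , suc-injective eq)) (here refl))
compositions-complete (suc n) (suc zero ∷ x ∷ xs) (_ ∷ pos , eq)   =
  ∈-concatMap⁺ extend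
    (lose (compositions-complete n (x ∷ xs) (pos , suc-injective eq)) (here refl))
compositions-complete (suc n) (suc (suc x) ∷ xs) (_ ∷ pos , eq)    =
  ∈-concatMap⁺ extend
    (lose (compositions-complete n (suc x ∷ xs) (s≤s z≤n ∷ pos , suc-injective eq))
          (there (here refl)))

shrink : List ℕ → List ℕ
shrink (suc zero ∷ xs)    = xs
shrink (suc (suc x) ∷ xs) = suc x ∷ xs
shrink xs                 = xs

shrink-extend : ∀ xs {ys} → All (_> 0) xs → ys ∈ extend xs → shrink ys ≡ xs
shrink-extend []           _ (here refl)         = refl
shrink-extend (x ∷ xs)     _ (here refl)         = refl
shrink-extend (suc x ∷ xs) _ (there (here refl)) = refl
shrink-extend (zero ∷ xs)  (() ∷ _) _

extend-unique : ∀ xs → All (_> 0) xs → Unique (extend xs)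
extend-unique []           _        = [] ∷ []
extend-unique (zero ∷ xs)  (() ∷ _)
extend-unique (suc x ∷ xs) _        = ((λ ()) ∷ []) ∷ [] ∷ []

compositions-unique : ∀ n → Unique (compositions n)
compositions-unique zero    = [] ∷ []
compositions-unique (suc n) = concat⁺
  (map⁺ (All.map (extend-unique _) positive))
  (disjoint positive (compositions-unique n))
  where
  positive : All (All (_> 0)) (compositions n)
  positive = All.tabulate (proj₁ ∘ compositions-sound n)

  disjoint₁ : ∀ {xs yss} → All (_> 0) xs → All (All (_> 0)) yss → All (xs ≢_) yss →
              All (Disjoint (extend xs)) (map extend yss)
  disjoint₁ px []         []           = []
  disjoint₁ px (py ∷ pys) (x≢y ∷ x≢ys) =
    (λ (z∈x , z∈y) →
       x≢y (trans (sym (shrink-extend _ px z∈x)) (shrink-extend _ py z∈y)))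
    ∷ disjoint₁ px pys x≢ys

  disjoint : ∀ {xss} → All (All (_> 0)) xss → Unique xss →
             AllPairs Disjoint (map extend xss)
  disjoint []         []         = []
  disjoint (px ∷ pxs) (x≢ ∷ uxs) = disjoint₁ px pxs x≢ ∷ disjoint pxs uxs

partitions-sound : ∀ n {xs} → xs ∈ partitions n → IsPartition n xs
partitions-sound n xs∈ =
  let xs∈comps , dec = ∈-filter⁻ (linked? _≥?_) {xs = compositions n} xs∈
  in  compositions-sound n xs∈comps , dec

partitions-complete : ∀ n {xs} → IsPartition n xs → xs ∈ partitions n
partitions-complete n (comp , dec) =
  ∈-filter⁺ (linked? _≥?_) (compositions-complete n _ comp) dec

partitions-unique : ∀ n → Unique (partitions n)
partitions-unique n = filter⁺ (linked? _≥?_) (compositions-unique n)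

-- Modulo 2, b 2 N is odd only if 24 N + 1 is a square, while here
-- 24 N + 1 = (p₁ ⋯ p_{r-1})² p_r (24 p_r n + 24 i + p_r) has odd p_r-adic valuation.
-- For the first claim let O be the product of 1 + q^k over odd k, and P the product
-- over all k ≥ 1. The generating function of b 2 is 1 / O; Frobenius makes O P
-- invariant under q ↦ q², so O P = 1 and 1 / O = P. Shanks' finite identity,
-- a telescoping sum, reduces P to the sum of q^m over generalised pentagonal m.
{-# OPTIONS --safe #-}
module Submission where

open import Defs
open import Data.Nat
  using (ℕ; zero; suc; _+_; _*_; _∸_; _^_; _≤_; _<_; _>_; _≥_; _≤?_; z≤n; s≤s; s≤s⁻¹; NonZero; >-nonZero; parity)
open import Data.Nat.DivMod using (_/_; _%_; m%n<n; m≡m%n+[m/n]*n; m*n/n≡m; [m+kn]%n≡m%n; %-distribˡ-*)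
open import Data.Nat.Divisibility
open import Data.Nat.Induction using (<-rec)
open import Data.Nat.ListAction using (sum)
open import Data.Nat.Primality using (Prime; euclidsLemma; prime⇒irreducible; prime⇒nonZero)
open import Data.Nat.Properties
open import Data.Nat.Tactic.RingSolver using (solve-∀)
open import Data.Parity.Base using (Parity; 0ℙ; 1ℙ) renaming (_+_ to _⊕_)
import Data.Parity.Properties as ℙ
import Algebra.Properties.CommutativeSemigroup ℙ.+-commutativeSemigroup as ⊕
open import Data.Empty using (⊥; ⊥-elim)
import Data.Fin as Fin
open import Data.List using (List; []; _∷_; _++_; length; filter) renaming (map to mapᴸ)
open import Data.List.Properties using (length-++; length-map; filter-all; ∷-injectiveʳ)
open import Data.List.Membership.Propositional using (_∈_)
open import Data.List.Membership.Propositional.Properties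
  using (∈-filter⁺; ∈-filter⁻; ∈-map⁺; ∈-map⁻; ∈-++⁺ˡ; ∈-++⁺ʳ; ∈-++⁻)
open import Data.List.Membership.Propositional.Properties.WithK using (unique∧set⇒bag)
open import Data.List.Relation.Binary.BagAndSetEquality using (∼bag⇒↭)
open import Data.List.Relation.Binary.Permutation.Propositional.Properties using (↭-length)
open import Data.List.Relation.Binary.Subset.Propositional using (_⊆_)
open import Data.List.Relation.Unary.All as All using (All; []; _∷_)
open import Data.List.Relation.Unary.Linked using (Linked; []; [-]; _∷_) renaming (tail to linked-tail)
open import Data.List.Relation.Unary.Linked.Properties using (Linked⇒All)
open import Data.List.Relation.Unary.Unique.Propositional using (Unique; [])
import Data.List.Relation.Unary.Unique.Propositional.Properties as Unique
open import Data.Product using (∃; _×_; _,_; proj₁)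
open import Data.Sum using (_⊎_; inj₁; inj₂; [_,_]′)
open import Data.Vec.Functional using (Vector; init; last; map)
open import Function using (_∘_; id)
open import Function.Bundles using (mk⇔)
open import Relation.Nullary using (¬_; yes; no)
open import Relation.Nullary.Decidable using (from-yes; _⊎-dec_)
open import Relation.Binary.PropositionalEquality
  using (_≡_; _≢_; _≗_; refl; sym; trans; cong; cong₂; subst; module ≡-Reasoning)

-- Power series over the field with two elements.
Series : Set
Series = ℕ → Parity

𝟙 : Series
𝟙 zero    = 1ℙ
𝟙 (suc _) = 0ℙ

-- Multiplication by q ^ k.
shift : ℕ → Series → Series
shift zero    f n       = f n
shift (suc k) f zero    = 0ℙ
shift (suc k) f (suc n) = shift k f n

-- Multiplication by 1 + q ^ k.
factor : ℕ → Series → Series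
factor k f n = f n ⊕ shift k f n

-- Products act as operators built from shifts, so commutation lemmas take the place of
-- commutativity of series multiplication.
factors : (ℕ → ℕ) → ℕ → Series → Series
factors e zero    f = f
factors e (suc h) f = factor (e h) (factors e h f)

infix 4 _≈[_]_
-- Congruence modulo q^(m+1); it lets finite products stand for infinite ones.
_≈[_]_ : Series → ℕ → Series → Set
f ≈[ m ] g = ∀ {n} → n ≤ m → f n ≡ g n

shift-< : ∀ k f {n} → n < k → shift k f n ≡ 0ℙ
shift-< (suc k) f {zero}  _         = refl
shift-< (suc k) f {suc n} (s≤s n<k) = shift-< k f n<k

shift-≥ : ∀ k f d → shift k f (k + d) ≡ f d
shift-≥ zero    f d = refl
shift-≥ (suc k) f d = shift-≥ k f d

shift-𝟙 : ∀ k n → n ≢ k → shift k 𝟙 n ≡ 0ℙ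
shift-𝟙 zero    zero     n≢k with () ← n≢k refl
shift-𝟙 zero    (suc n) n≢k = refl
shift-𝟙 (suc k) zero     n≢k = refl
shift-𝟙 (suc k) (suc n) n≢k = shift-𝟙 k n (n≢k ∘ cong suc)

shift-trunc : ∀ k {f g m} → f ≈[ m ] g → shift k f ≈[ m ] shift k g
shift-trunc zero    f≈g n≤m = f≈g n≤m
shift-trunc (suc k) f≈g {zero}  n≤m = refl
shift-trunc (suc k) f≈g {suc n} n<m = shift-trunc k f≈g (<⇒≤ n<m)

shift-cong : ∀ k {f g} → f ≗ g → shift k f ≗ shift k g
shift-cong k f≗g n = shift-trunc k {m = n} (λ _ → f≗g _) ≤-refl

shift-⊕ : ∀ k f g n → shift k (λ m → f m ⊕ g m) n ≡ shift k f n ⊕ shift k g n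
shift-⊕ zero    f g n       = refl
shift-⊕ (suc k) f g zero    = refl
shift-⊕ (suc k) f g (suc n) = shift-⊕ k f g n

shift-+ : ∀ j k f → shift j (shift k f) ≗ shift (j + k) f
shift-+ zero    k f n       = refl
shift-+ (suc j) k f zero    = refl
shift-+ (suc j) k f (suc n) = shift-+ j k f n

shift-factor : ∀ j k f n → shift j (factor k f) n ≡ shift j f n ⊕ shift (j + k) f n
shift-factor j k f n =
  trans (shift-⊕ j f (shift k f) n) (cong (shift j f n ⊕_) (shift-+ j k f n))

factor-trunc : ∀ k {f g m} → f ≈[ m ] g → factor k f ≈[ m ] factor k g
factor-trunc k f≈g n≤m = cong₂ _⊕_ (f≈g n≤m) (shift-trunc k f≈g n≤m)

factor-cong : ∀ k {f g} → f ≗ g → factor k f ≗ factor k g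
factor-cong k f≗g n = cong₂ _⊕_ (f≗g n) (shift-cong k f≗g n)

factor-large : ∀ {k m} f → m < k → factor k f ≈[ m ] f
factor-large {k} f m<k n≤m =
  trans (cong (f _ ⊕_) (shift-< k f (≤-<-trans n≤m m<k))) (ℙ.+-identityʳ _)

factor-comm : ∀ j k f → factor j (factor k f) ≗ factor k (factor j f)
factor-comm j k f n = begin
  (f n ⊕ shift k f n) ⊕ shift j (factor k f) n
    ≡⟨ cong ((f n ⊕ shift k f n) ⊕_) (shift-factor j k f n) ⟩
  (f n ⊕ shift k f n) ⊕ (shift j f n ⊕ shift (j + k) f n)
    ≡⟨ ⊕.interchange (f n) _ _ _ ⟩
  (f n ⊕ shift j f n) ⊕ (shift k f n ⊕ shift (j + k) f n)
    ≡⟨ cong (λ i → (f n ⊕ shift j f n) ⊕ (shift k f n ⊕ shift i f n)) (+-comm j k) ⟩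
  (f n ⊕ shift j f n) ⊕ (shift k f n ⊕ shift (k + j) f n)
    ≡⟨ cong ((f n ⊕ shift j f n) ⊕_) (shift-factor k j f n) ⟨
  (f n ⊕ shift j f n) ⊕ shift k (factor j f) n ∎
  where open ≡-Reasoning

-- Frobenius in characteristic 2: the two copies of `shift k f` cancel.
factor-square : ∀ k f → factor k (factor k f) ≗ factor (k + k) f
factor-square k f n = begin
  (f n ⊕ shift k f n) ⊕ shift k (factor k f) n
    ≡⟨ cong ((f n ⊕ shift k f n) ⊕_) (shift-factor k k f n) ⟩
  (f n ⊕ shift k f n) ⊕ (shift k f n ⊕ shift (k + k) f n)
    ≡⟨ ℙ.+-assoc (f n) _ _ ⟩
  f n ⊕ (shift k f n ⊕ (shift k f n ⊕ shift (k + k) f n))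
    ≡⟨ cong (f n ⊕_) (cancel (shift k f n) _) ⟩
  f n ⊕ shift (k + k) f n ∎
  where
  open ≡-Reasoning
  cancel : ∀ p q → p ⊕ (p ⊕ q) ≡ q
  cancel p q = trans (sym (ℙ.+-assoc p p q)) (cong (_⊕ q) (ℙ.p+p≡0ℙ p))

-- The constant term of 1 + q^(k+1) is 1, so each coefficient of `f` is recovered from the product
-- and the lower coefficients.
factor-injective : ∀ k {f g m} → factor (suc k) f ≈[ m ] factor (suc k) g → f ≈[ m ] g
factor-injective k {f} {g} {m} eq {n} = <-rec (λ n → n ≤ m → f n ≡ g n) step n
  where
  step : ∀ n → (∀ {j} → j < n → j ≤ m → f j ≡ g j) → n ≤ m → f n ≡ g n
  step zero    rec n≤m = ℙ.+-cancelʳ-≡ 0ℙ _ _ (eq n≤m)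
  step (suc n) rec n<m = ℙ.+-cancelʳ-≡ (shift k g n) _ _
    (trans (cong (f (suc n) ⊕_) (sym lower)) (eq n<m))
    where
    lower : shift k f n ≡ shift k g n
    lower = shift-trunc k {m = n} (λ j≤n → rec (s≤s j≤n) (≤-trans j≤n (<⇒≤ n<m))) ≤-refl

-- Finite products of factors 1 + q^e

factors-trunc : ∀ e h {f g m} → f ≈[ m ] g → factors e h f ≈[ m ] factors e h g
factors-trunc e zero    f≈g = f≈g
factors-trunc e (suc h) f≈g = factor-trunc (e h) (factors-trunc e h f≈g)

factors-cong : ∀ e h {f g} → f ≗ g → factors e h f ≗ factors e h g
factors-cong e zero    f≗g = f≗g
factors-cong e (suc h) f≗g = factor-cong (e h) (factors-cong e h f≗g)

factors-exponents : ∀ {e e′} → e ≗ e′ → ∀ h f → factors e h f ≗ factors e′ h f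
factors-exponents         e≗e′ zero    f n = refl
factors-exponents {e} {e′} e≗e′ (suc h) f n = trans
  (factor-cong (e h) (factors-exponents e≗e′ h f) n)
  (cong (λ k → factor k (factors e′ h f) n) (e≗e′ h))

factors-injective : ∀ e h {f g m} →
  factors (suc ∘ e) h f ≈[ m ] factors (suc ∘ e) h g → f ≈[ m ] g
factors-injective e zero    eq = eq
factors-injective e (suc h) {f} {g} eq = factors-injective e h
  (factor-injective (e h) {factors (suc ∘ e) h f} {factors (suc ∘ e) h g} eq)

factors-factor : ∀ e h k f → factors e h (factor k f) ≗ factor k (factors e h f)
factors-factor e zero    k f n = refl
factors-factor e (suc h) k f n = trans
  (factor-cong (e h) (factors-factor e h k f) n) (factor-comm (e h) k (factors e h f) n)

factors-comm : ∀ e h e′ h′ f →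
  factors e h (factors e′ h′ f) ≗ factors e′ h′ (factors e h f)
factors-comm e h e′ zero     f n = refl
factors-comm e h e′ (suc h′) f n = trans
  (factors-factor e h (e′ h′) (factors e′ h′ f) n)
  (factor-cong (e′ h′) (factors-comm e h e′ h′ f) n)

-- `factors` peels off the last exponent by definition; since factors commute, the first can be
-- peeled off instead.
factors-shift : ∀ e h f → factors e (suc h) f ≗ factor (e 0) (factors (e ∘ suc) h f)
factors-shift e zero    f n = refl
factors-shift e (suc h) f n = trans
  (factor-cong (e (suc h)) (factors-shift e h f) n)
  (factor-comm (e (suc h)) (e 0) (factors (e ∘ suc) h f) n)

factors-stable : ∀ e d h f {m} → (∀ j → j ≥ h → e j > m) →
  factors e (d + h) f ≈[ m ] factors e h f
factors-stable e zero    h f large n≤m = refl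
factors-stable e (suc d) h f large n≤m = trans
  (factor-large (factors e (d + h) f) (large (d + h) (m≤n+m h d)) n≤m)
  (factors-stable e d h f large n≤m)

factors-merge : ∀ e h f →
  factors e h (factors e h f) ≗ factors (λ j → e j + e j) h f
factors-merge e zero    f n = refl
factors-merge e (suc h) f n = begin
  factor (e h) (factors e h (factor (e h) (factors e h f))) n
    ≡⟨ factor-cong (e h) (factors-factor e h (e h) (factors e h f)) n ⟩
  factor (e h) (factor (e h) (factors e h (factors e h f))) n
    ≡⟨ factor-square (e h) (factors e h (factors e h f)) n ⟩
  factor (e h + e h) (factors e h (factors e h f)) n
    ≡⟨ factor-cong (e h + e h) (factors-merge e h f) n ⟩
  factor (e h + e h) (factors (λ j → e j + e j) h f) n ∎
  where open ≡-Reasoning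

-- The substitution of q ^ 2 for q.
dilate : Series → Series
dilate f zero          = f zero
dilate f (suc zero)    = 0ℙ
dilate f (suc (suc n)) = dilate (f ∘ suc) n

dilate-cong : ∀ {f g} → f ≗ g → dilate f ≗ dilate g
dilate-cong f≗g zero          = f≗g zero
dilate-cong f≗g (suc zero)    = refl
dilate-cong f≗g (suc (suc n)) = dilate-cong (f≗g ∘ suc) n

dilate-⊕ : ∀ f g n → dilate (λ m → f m ⊕ g m) n ≡ dilate f n ⊕ dilate g n
dilate-⊕ f g zero          = refl
dilate-⊕ f g (suc zero)    = refl
dilate-⊕ f g (suc (suc n)) = dilate-⊕ (f ∘ suc) (g ∘ suc) n

dilate-shift : ∀ k f → shift (k + k) (dilate f) ≗ dilate (shift k f)
dilate-shift zero    f n = refl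
dilate-shift (suc k) f n rewrite +-suc k k = go n
  where
  go : shift (suc (suc (k + k))) (dilate f) ≗ dilate (shift (suc k) f)
  go zero          = refl
  go (suc zero)    = refl
  go (suc (suc n)) = dilate-shift k f n

dilate-𝟙 : dilate 𝟙 ≗ 𝟙
dilate-𝟙 zero          = refl
dilate-𝟙 (suc zero)    = refl
dilate-𝟙 (suc (suc n)) = dilate-0 n
  where
  dilate-0 : ∀ n → dilate (λ _ → 0ℙ) n ≡ 0ℙ
  dilate-0 zero          = refl
  dilate-0 (suc zero)    = refl
  dilate-0 (suc (suc n)) = dilate-0 n

factor-dilate : ∀ k f → factor (k + k) (dilate f) ≗ dilate (factor k f)
factor-dilate k f n = trans
  (cong (dilate f n ⊕_) (dilate-shift k f n)) (sym (dilate-⊕ f (shift k f) n))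

factors-dilate : ∀ e h f → factors (λ j → e j + e j) h (dilate f) ≗ dilate (factors e h f)
factors-dilate e zero    f n = refl
factors-dilate e (suc h) f n = trans
  (factor-cong (e h + e h) (factors-dilate e h f) n)
  (factor-dilate (e h) (factors e h f) n)

-- Odd parts versus distinct parts

odd : ℕ → ℕ
odd j = suc (j + j)

-- Starts at 2, so that the product over `even` is the product over `suc` after q ↦ q².
even : ℕ → ℕ
even j = suc j + suc j

split-parity : ∀ h f → factors suc (h + h) f ≗ factors odd h (factors even h f)
split-parity zero    f n = refl
split-parity (suc h) f n = trans (cong (λ m → factors suc (suc m) f n) (+-suc h h))
  (begin
  factor (suc (suc (h + h))) (factor (odd h) (factors suc (h + h) f)) n
    ≡⟨ cong (λ m → factor m (factor (odd h) (factors suc (h + h) f)) n) (cong suc (+-suc h h)) ⟨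
  factor (even h) (factor (odd h) (factors suc (h + h) f)) n
    ≡⟨ factor-cong (even h) (factor-cong (odd h) (split-parity h f)) n ⟩
  factor (even h) (factor (odd h) (factors odd h (factors even h f))) n
    ≡⟨ factors-factor odd (suc h) (even h) (factors even h f) n ⟨
  factor (odd h) (factors odd h (factor (even h) (factors even h f))) n ∎)
  where open ≡-Reasoning

-- A truncation of O P that is exact through degree h.
eulerProduct : ℕ → Series
eulerProduct h = factors odd h (factors suc h 𝟙)

eulerProduct-stable : ∀ d h {m} → m ≤ h → eulerProduct (d + h) ≈[ m ] eulerProduct h
eulerProduct-stable d h {m} m≤h n≤m = trans
  (factors-stable odd d h (factors suc (d + h) 𝟙)
    (λ j j≥h → s≤s (≤-trans m≤h (≤-trans j≥h (m≤m+n j j)))) n≤m)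
  (factors-trunc odd h
    (factors-stable suc d h 𝟙 (λ j j≥h → s≤s (≤-trans m≤h j≥h))) n≤m)

-- With O = ∏ (1 + q ^ (2j+1)) and P = ∏ (1 + q ^ j) = O(q) P(q²), Frobenius
-- gives O(q) P(q) = O(q)² P(q²) = O(q²) P(q²).
eulerProduct-dilate : ∀ h → eulerProduct (h + h) ≈[ h + h ] dilate (eulerProduct h)
eulerProduct-dilate h {n} n≤2h = begin
  factors odd (h + h) (factors suc (h + h) 𝟙) n
    -- Odd exponents above 2h are invisible here; dropping them gives the two odd products equal
    -- length, so that they merge into squares.
    ≡⟨ factors-stable odd h h (factors suc (h + h) 𝟙) (λ j j≥h → s≤s (+-mono-≤ j≥h j≥h)) n≤2h ⟩
  factors odd h (factors suc (h + h) 𝟙) n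
    ≡⟨ factors-cong odd h (split-parity h 𝟙) n ⟩
  factors odd h (factors odd h (factors even h 𝟙)) n
    ≡⟨ factors-merge odd h (factors even h 𝟙) n ⟩
  factors odd² h (factors even h 𝟙) n
    ≡⟨ factors-cong odd² h (factors-cong even h dilate-𝟙) n ⟨
  factors odd² h (factors even h (dilate 𝟙)) n
    ≡⟨ factors-cong odd² h (factors-dilate suc h 𝟙) n ⟩
  factors odd² h (dilate (factors suc h 𝟙)) n
    ≡⟨ factors-dilate odd h (factors suc h 𝟙) n ⟩
  dilate (eulerProduct h) n ∎
  where
  open ≡-Reasoning
  odd² : ℕ → ℕ
  odd² j = odd j + odd j

-- The coefficient of the dilation at an even n > 0 is that of `f` at n/2, which lies strictly
-- between 0 and n.
dilate-≈𝟙 : ∀ f n → (∀ k → k < n → f k ≡ 𝟙 k) → f 0 ≡ 1ℙ → dilate f n ≡ 𝟙 n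
dilate-≈𝟙 f zero          f≡𝟙 f0 = f0
dilate-≈𝟙 f (suc zero)    f≡𝟙 f0 = refl
dilate-≈𝟙 f (suc (suc n)) f≡𝟙 f0 =
  vanish (f ∘ suc) n (λ k k≤n → f≡𝟙 (suc k) (s≤s (s≤s k≤n)))
  where
  vanish : ∀ g n → (∀ k → k ≤ n → g k ≡ 0ℙ) → dilate g n ≡ 0ℙ
  vanish g zero          g≡0 = g≡0 0 z≤n
  vanish g (suc zero)    g≡0 = refl
  vanish g (suc (suc n)) g≡0 =
    vanish (g ∘ suc) n (λ k k≤n → g≡0 (suc k) (s≤s (m≤n⇒m≤1+n k≤n)))

-- A series with constant term 1 that is invariant under q ↦ q² equals 1, by strong induction on the
-- degree. The induction hypothesis covers all h because the step changes the truncation.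
eulerProduct≈𝟙 : ∀ h → eulerProduct h ≈[ h ] 𝟙
eulerProduct≈𝟙 h {n} = <-rec (λ n → ∀ h → n ≤ h → eulerProduct h n ≡ 𝟙 n) step n h
  where
  stable : ∀ n {h} → n ≤ h → eulerProduct h n ≡ eulerProduct n n
  stable n {h} n≤h = trans
    (cong (λ m → eulerProduct m n) (sym (m∸n+n≡m n≤h)))
    (eulerProduct-stable (h ∸ n) n ≤-refl ≤-refl)

  step : ∀ n → (∀ {k} → k < n → ∀ h → k ≤ h → eulerProduct h k ≡ 𝟙 k) →
         ∀ h → n ≤ h → eulerProduct h n ≡ 𝟙 n
  step n rec h n≤h = begin
    eulerProduct h n          ≡⟨ stable n n≤h ⟩
    eulerProduct n n          ≡⟨ stable n (m≤m+n n n) ⟨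
    eulerProduct (n + n) n    ≡⟨ eulerProduct-dilate n (m≤m+n n n) ⟩
    dilate (eulerProduct n) n
      ≡⟨ dilate-≈𝟙 (eulerProduct n) n (λ k k<n → rec k<n n (<⇒≤ k<n)) (stable 0 {n} z≤n) ⟩
    𝟙 n                       ∎
    where open ≡-Reasoning

-- Both `f` and P are inverse to O, and O can be cancelled because its exponents are positive.
factors-odd⇒factors-suc : ∀ h {f} → factors odd h f ≈[ h ] 𝟙 → f ≈[ h ] factors suc h 𝟙
factors-odd⇒factors-suc h eq = factors-injective (λ j → j + j) h
  (λ n≤h → trans (eq n≤h) (sym (eulerProduct≈𝟙 h n≤h)))

-- Euler's pentagonal number theorem modulo 2

triangle : ℕ → ℕ
triangle zero    = 0
triangle (suc s) = triangle s + suc s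

-- (1 + q ^ (s + 1)) ⋯ (1 + q ^ n)
tail : ℕ → ℕ → Series
tail n s = factors (λ j → suc (s + j)) (n ∸ s) 𝟙

tail-sucˡ : ∀ {n s} → s ≤ n → tail (suc n) s ≗ factor (suc n) (tail n s)
tail-sucˡ {n} {s} s≤n m rewrite +-∸-assoc 1 s≤n | m+[n∸m]≡n s≤n = refl

tail-sucʳ : ∀ {n s} → s < n → tail n s ≗ factor (suc s) (tail n (suc s))
tail-sucʳ {suc n} {s} (s≤s s≤n) m rewrite +-∸-assoc 1 s≤n = trans
  (factors-shift (λ j → suc (s + j)) (n ∸ s) 𝟙 m)
  (trans (factor-cong (suc (s + 0)) (factors-exponents (cong suc ∘ +-suc s) (n ∸ s) 𝟙) m)
    (cong (λ k → factor (suc k) (tail (suc n) (suc s)) m) (+-identityʳ s)))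

tail-self : ∀ n → tail n n ≗ 𝟙
tail-self n m rewrite n∸n≡0 n = refl

-- The summands of Shanks' identity: for fixed n their sum over s ≤ n is the
-- pentagonal series truncated after its n-th pair of exponents.
term : ℕ → ℕ → Series
term n s = shift (s * n + triangle s) (tail n s)

bridge : ℕ → ℕ → Series
bridge n s = shift (suc s * suc n + triangle s) (tail n s)

∑≤ : ℕ → (ℕ → Series) → Series
∑≤ zero    f n = f 0 n
∑≤ (suc t) f n = ∑≤ t f n ⊕ f (suc t) n

-- bridge n s is the remainder after s when term (suc n) is compared with term n.
term-zero : ∀ n m → term (suc n) 0 m ≡ term n 0 m ⊕ bridge n 0 m
term-zero n m = trans (tail-sucˡ {n} z≤n m)
  (cong (λ k → tail n 0 m ⊕ shift k (tail n 0) m) (lemma n))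
  where
  lemma : ∀ n → suc n ≡ (1 * suc n) + 0
  lemma = solve-∀

-- Splitting off one factor on each side leaves four shifts of the common tail `R`. Since u + (s +
-- 1) = v, the two middle ones agree and cancel modulo 2; the outer two form the right-hand side.
term-suc : ∀ {n s} → s < n → ∀ m →
  bridge n s m ⊕ term (suc n) (suc s) m ≡ term n (suc s) m ⊕ bridge n (suc s) m
term-suc {n} {s} s<n m = begin
  bridge n s m ⊕ term (suc n) (suc s) m
    ≡⟨ cong₂ _⊕_ (shift-cong u (tail-sucʳ s<n) m) (shift-cong v (tail-sucˡ s<n) m) ⟩
  shift u (factor (suc s) R) m ⊕ shift v (factor (suc n) R) m
    ≡⟨ cong₂ _⊕_ (shift-factor u (suc s) R m) (shift-factor v (suc n) R m) ⟩
  (shift u R m ⊕ shift (u + suc s) R m) ⊕ (shift v R m ⊕ shift (v + suc n) R m)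
    ≡⟨ cong₂ (λ i j → (shift i R m ⊕ shift (u + suc s) R m) ⊕ (shift v R m ⊕ shift j R m))
         (lemma₁ s n (triangle s)) (lemma₃ s n (triangle s)) ⟩
  (term n (suc s) m ⊕ shift (u + suc s) R m) ⊕ (shift v R m ⊕ bridge n (suc s) m)
    ≡⟨ cong (λ i → (term n (suc s) m ⊕ shift i R m) ⊕ (shift v R m ⊕ bridge n (suc s) m))
         (lemma₂ s n (triangle s)) ⟩
  (term n (suc s) m ⊕ shift v R m) ⊕ (shift v R m ⊕ bridge n (suc s) m)
    ≡⟨ cancel (term n (suc s) m) (shift v R m) _ ⟩
  term n (suc s) m ⊕ bridge n (suc s) m ∎
  where
  open ≡-Reasoning
  R : Series
  R = tail n (suc s)
  u v : ℕ
  u = suc s * suc n + triangle s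
  v = suc s * suc n + triangle (suc s)

  lemma₁ : ∀ s n t → suc s * suc n + t ≡ suc s * n + (t + suc s)
  lemma₁ = solve-∀
  lemma₂ : ∀ s n t → suc s * suc n + t + suc s ≡ suc s * suc n + (t + suc s)
  lemma₂ = solve-∀
  lemma₃ : ∀ s n t → suc s * suc n + (t + suc s) + suc n ≡ suc (suc s) * suc n + (t + suc s)
  lemma₃ = solve-∀
  cancel : ∀ p q r → (p ⊕ q) ⊕ (q ⊕ r) ≡ p ⊕ r
  cancel p q r = trans (ℙ.+-assoc p q (q ⊕ r)) (cong (p ⊕_)
    (trans (sym (ℙ.+-assoc q q r)) (cong (_⊕ r) (ℙ.p+p≡0ℙ q))))

∑-telescope : ∀ n t → t ≤ n → ∀ m →
  ∑≤ t (term (suc n)) m ≡ ∑≤ t (term n) m ⊕ bridge n t m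
∑-telescope n zero    _   m = term-zero n m
∑-telescope n (suc t) t<n m = begin
  ∑≤ t (term (suc n)) m ⊕ term (suc n) (suc t) m
    ≡⟨ cong (_⊕ term (suc n) (suc t) m) (∑-telescope n t (<⇒≤ t<n) m) ⟩
  (∑≤ t (term n) m ⊕ bridge n t m) ⊕ term (suc n) (suc t) m
    ≡⟨ ℙ.+-assoc (∑≤ t (term n) m) _ _ ⟩
  ∑≤ t (term n) m ⊕ (bridge n t m ⊕ term (suc n) (suc t) m)
    ≡⟨ cong (∑≤ t (term n) m ⊕_) (term-suc t<n m) ⟩
  ∑≤ t (term n) m ⊕ (term n (suc t) m ⊕ bridge n (suc t) m)
    ≡⟨ ℙ.+-assoc (∑≤ t (term n) m) _ _ ⟨
  (∑≤ t (term n) m ⊕ term n (suc t) m) ⊕ bridge n (suc t) m ∎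
  where open ≡-Reasoning

-- Generalised pentagonal numbers a (3 a ± 1) / 2 are the m with 24 m + 1 = (6 a ± 1)².
NonPentagonal : ℕ → Set
NonPentagonal m = ∀ x → x * x ≢ 24 * m + 1

2*triangle : ∀ s → 2 * triangle s ≡ s * suc s
2*triangle zero    = refl
2*triangle (suc s) = trans (*-distribˡ-+ 2 (triangle s) (suc s))
  (trans (cong (_+ 2 * suc s) (2*triangle s)) (lemma s))
  where
  lemma : ∀ s → s * suc s + 2 * suc s ≡ suc s * suc (suc s)
  lemma = solve-∀

-- The square is given with 12 t (t + 1) in place of 24 `triangle t`, so that it can be checked as a
-- polynomial identity.
nonPentagonal⇒≢ : ∀ {m} → NonPentagonal m → ∀ x a t → x * x ≡ 24 * a + 12 * (t * suc t) + 1 →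
  m ≢ a + triangle t
nonPentagonal⇒≢ np x a t eq refl = np x (trans eq (cong (_+ 1) (begin
  24 * a + 12 * (t * suc t)        ≡⟨ cong (λ y → 24 * a + 12 * y) (2*triangle t) ⟨
  24 * a + 12 * (2 * triangle t)   ≡⟨ lemma a (triangle t) ⟩
  24 * (a + triangle t) ∎)))
  where
  open ≡-Reasoning
  lemma : ∀ a u → 24 * a + 12 * (2 * u) ≡ 24 * (a + u)
  lemma = solve-∀

-- Going from n to n + 1 adds two monomials, the last bridge and the last term, whose tails are
-- empty. Their exponents are a (3 a - 1) / 2 and a (3 a + 1) / 2 with a = n + 1.
∑-nonPentagonal : ∀ n m → NonPentagonal m → ∑≤ n (term n) m ≡ 0ℙ
∑-nonPentagonal zero    m np = shift-𝟙 0 m (λ { refl → np 1 refl })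
∑-nonPentagonal (suc n) m np = begin
  ∑≤ n (term (suc n)) m ⊕ term (suc n) (suc n) m
    ≡⟨ cong₂ _⊕_ (∑-telescope n n ≤-refl m) (shift-cong (suc n * suc n + triangle (suc n)) (tail-self (suc n)) m) ⟩
  (∑≤ n (term n) m ⊕ bridge n n m) ⊕ shift (suc n * suc n + triangle (suc n)) 𝟙 m
    ≡⟨ cong₂ _⊕_ (cong₂ _⊕_ (∑-nonPentagonal n m np)
         (trans (shift-cong (suc n * suc n + triangle n) (tail-self n) m)
           -- The square roots 6 n + 5 and 6 n + 7 are 6 a - 1 and 6 a + 1 for a = n + 1.
           (shift-𝟙 _ m (nonPentagonal⇒≢ {m} np (6 * n + 5) (suc n * suc n) n (lemma₁ n)))))
         (shift-𝟙 _ m (nonPentagonal⇒≢ {m} np (6 * n + 7) (suc n * suc n) (suc n) (lemma₂ n))) ⟩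
  0ℙ ∎
  where
  open ≡-Reasoning
  lemma₁ : ∀ n → (6 * n + 5) * (6 * n + 5) ≡ 24 * (suc n * suc n) + 12 * (n * suc n) + 1
  lemma₁ = solve-∀
  lemma₂ : ∀ n → (6 * n + 7) * (6 * n + 7) ≡ 24 * (suc n * suc n) + 12 * (suc n * suc (suc n)) + 1
  lemma₂ = solve-∀

-- The summand at s = 0 is the whole product, and those with s ≥ 1 start in degree at least n.
∑-leading : ∀ n t {m} → m < n → ∑≤ t (term n) m ≡ factors suc n 𝟙 m
∑-leading n zero    m<n = refl
∑-leading n (suc t) m<n = trans
  (cong₂ _⊕_ (∑-leading n t m<n)
    (shift-< _ (tail n (suc t)) (<-≤-trans m<n (≤-trans (m≤m+n n (t * n)) (m≤m+n _ _)))))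
  (ℙ.+-identityʳ _)

factors-suc-nonPentagonal : ∀ {n m} → m < n → NonPentagonal m → factors suc n 𝟙 m ≡ 0ℙ
factors-suc-nonPentagonal {n} {m} m<n np =
  trans (sym (∑-leading n n m<n)) (∑-nonPentagonal n m np)

-- Partitions into odd parts

-- Counting by double inclusion: duplicate-free lists with the same elements are permutations of
-- each other.
unique⇒length≡ : ∀ {A : Set} {xs ys : List A} → Unique xs → Unique ys →
  xs ⊆ ys → ys ⊆ xs → length xs ≡ length ys
unique⇒length≡ xs! ys! xs⊆ys ys⊆xs =
  ↭-length (∼bag⇒↭ (unique∧set⇒bag xs! ys! (mk⇔ xs⊆ys ys⊆xs)))

-- As the parts are odd, the bound 2j admits exactly the first j odd numbers, `odd 0` to
-- `odd (j - 1)`.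
BoundedRegular : ℕ → ℕ → List ℕ → Set
BoundedRegular j n xs = (IsPartition n xs × Regular 2 xs) × All (_≤ j + j) xs

boundedRegular : ℕ → ℕ → List (List ℕ)
boundedRegular j n = filter (All.all? (_≤? j + j)) (filter (regular? 2) (partitions n))

boundedRegular-sound : ∀ j n {xs} → xs ∈ boundedRegular j n → BoundedRegular j n xs
boundedRegular-sound j n xs∈ =
  let xs∈reg , bounded = ∈-filter⁻ (All.all? (_≤? j + j)) {xs = filter (regular? 2) (partitions n)} xs∈
      xs∈part , reg = ∈-filter⁻ (regular? 2) {xs = partitions n} xs∈reg
  in  (partitions-sound n xs∈part , reg) , bounded

boundedRegular-complete : ∀ j n {xs} → BoundedRegular j n xs → xs ∈ boundedRegular j n
boundedRegular-complete j n ((part , reg) , bounded) =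
  ∈-filter⁺ (All.all? (_≤? j + j)) (∈-filter⁺ (regular? 2) (partitions-complete n part) reg) bounded

boundedRegular-unique : ∀ j n → Unique (boundedRegular j n)
boundedRegular-unique j n = Unique.filter⁺ _ (Unique.filter⁺ _ (partitions-unique n))

-- Modulo 2 this is the inverse of the product of the first j factors 1 + q^(2i+1).
count : ℕ → Series
count j n = parity (length (boundedRegular j n))

2∣m+m : ∀ m → 2 ∣ m + m
2∣m+m m = divides m (sym (trans (*-comm m 2) (cong (m +_) (+-identityʳ m))))

2∤odd : ∀ j → ¬ 2 ∣ odd j
2∤odd j 2∣ with s≤s () ← ∣⇒≤ (∣m+n∣m⇒∣n (subst (2 ∣_) (+-comm 1 (j + j)) 2∣) (2∣m+m j))

2∤⇒≤odd : ∀ {j x} → ¬ 2 ∣ x → x ≤ even j → x ≤ odd j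
2∤⇒≤odd {j} {x} 2∤x x≤ = subst (x ≤_) (+-suc j j)
  (s≤s⁻¹ (≤∧≢⇒< x≤ λ { refl → 2∤x (2∣m+m (suc j)) }))

bound-suc : ∀ {j x} → x ≤ j + j → x ≤ even j
bound-suc {j} x≤ = ≤-trans x≤ (+-mono-≤ (n≤1+n j) (n≤1+n j))

boundedRegular-grow : ∀ {j n xs} → BoundedRegular j n xs → BoundedRegular (suc j) n xs
boundedRegular-grow {j} (p , bounded) = p , All.map (bound-suc {j}) bounded

odd≤even : ∀ j → odd j ≤ even j
odd≤even j = s≤s (+-monoʳ-≤ j (n≤1+n j))

linked-cons : ∀ {x xs} → All (_≤ x) xs → Linked _≥_ xs → Linked _≥_ (x ∷ xs)
linked-cons []         []         = [-]
linked-cons (y≤x ∷ _)  [-]        = y≤x ∷ [-]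
linked-cons (y≤x ∷ _)  (r ∷ rs)   = y≤x ∷ r ∷ rs

boundedRegular-cons : ∀ {j d xs} →
  BoundedRegular (suc j) d xs → BoundedRegular (suc j) (odd j + d) (odd j ∷ xs)
boundedRegular-cons {j} ((((pos , refl) , dec) , reg) , bounded) =
  (((s≤s z≤n ∷ pos , refl) ,
    linked-cons (All.zipWith (λ (2∤x , x≤) → 2∤⇒≤odd {j} 2∤x x≤) (reg , bounded)) dec) ,
   2∤odd j ∷ reg) , odd≤even j ∷ bounded

-- The first part is the largest. Either it is at most 2j and bounds all others, or, being odd and
-- at most 2j + 2, it is `odd j` and can be removed.
boundedRegular-split : ∀ {j n xs} → BoundedRegular (suc j) n xs →
  BoundedRegular j n xs ⊎ ∃ λ ys → xs ≡ odd j ∷ ys × ∃ λ d → n ≡ odd j + d × BoundedRegular (suc j) d ys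
boundedRegular-split {xs = []} (p , bounded) = inj₁ (p , [])
boundedRegular-split {j} {n} {xs = x ∷ xs} ((((pos ∷ poss , eq) , dec) , 2∤x ∷ reg) , x≤ ∷ bounded)
  with x ≤? j + j
... | yes x≤2j = inj₁ ((((pos ∷ poss , eq) , dec) , 2∤x ∷ reg) ,
        All.map (λ y≤x → ≤-trans y≤x x≤2j) (Linked⇒All (λ p q → ≤-trans q p) ≤-refl dec))
... | no  x≰2j with refl ← ≤-antisym (2∤⇒≤odd {j} 2∤x x≤) (≰⇒> x≰2j) =
  inj₂ (xs , refl , sum xs , sym eq , (((poss , refl) , linked-tail dec) , reg) , bounded)

length-boundedRegular-< : ∀ j n → n < odd j →
  length (boundedRegular (suc j) n) ≡ length (boundedRegular j n)
length-boundedRegular-< j n n<odd = unique⇒length≡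
  (boundedRegular-unique (suc j) n) (boundedRegular-unique j n) to
  (boundedRegular-complete (suc j) n ∘ boundedRegular-grow ∘ boundedRegular-sound j n)
  where
  to : boundedRegular (suc j) n ⊆ boundedRegular j n
  to xs∈ with boundedRegular-split (boundedRegular-sound (suc j) n xs∈)
  ... | inj₁ p = boundedRegular-complete j n p
  ... | inj₂ (_ , _ , d , refl , _) = ⊥-elim (<⇒≱ n<odd (m≤m+n (odd j) d))

-- Prepending `odd j` produces exactly the partitions whose first part exceeds 2j, hence a list
-- disjoint from the one with bound 2j.
length-boundedRegular-+ : ∀ j d → length (boundedRegular (suc j) (odd j + d)) ≡
  length (boundedRegular j (odd j + d)) + length (boundedRegular (suc j) d)
length-boundedRegular-+ j d = begin
  length (boundedRegular (suc j) n)
    ≡⟨ unique⇒length≡ (boundedRegular-unique (suc j) n)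
         (Unique.++⁺ (boundedRegular-unique j n)
           (Unique.map⁺ ∷-injectiveʳ (boundedRegular-unique (suc j) d)) disjoint)
         to from ⟩
  length (boundedRegular j n ++ mapᴸ (odd j ∷_) (boundedRegular (suc j) d))
    ≡⟨ length-++ (boundedRegular j n) ⟩
  length (boundedRegular j n) + length (mapᴸ (odd j ∷_) (boundedRegular (suc j) d))
    ≡⟨ cong (length (boundedRegular j n) +_) (length-map (odd j ∷_) (boundedRegular (suc j) d)) ⟩
  length (boundedRegular j n) + length (boundedRegular (suc j) d) ∎
  where
  open ≡-Reasoning
  n : ℕ
  n = odd j + d

  disjoint : ∀ {xs} → ¬ (xs ∈ boundedRegular j n × xs ∈ mapᴸ (odd j ∷_) (boundedRegular (suc j) d))
  disjoint (xs∈₁ , xs∈₂) with _ , _ , refl ← ∈-map⁻ (odd j ∷_) xs∈₂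
    with _ , odd≤ ∷ _ ← boundedRegular-sound j n xs∈₁ = 1+n≰n odd≤

  to : boundedRegular (suc j) n ⊆ boundedRegular j n ++ mapᴸ (odd j ∷_) (boundedRegular (suc j) d)
  to xs∈ with boundedRegular-split (boundedRegular-sound (suc j) n xs∈)
  ... | inj₁ p = ∈-++⁺ˡ (boundedRegular-complete j n p)
  ... | inj₂ (_ , refl , d′ , eq , p) with refl ← +-cancelˡ-≡ (odd j) d d′ eq =
    ∈-++⁺ʳ (boundedRegular j n) (∈-map⁺ (odd j ∷_) (boundedRegular-complete (suc j) d p))

  from : boundedRegular j n ++ mapᴸ (odd j ∷_) (boundedRegular (suc j) d) ⊆ boundedRegular (suc j) n
  from xs∈ with ∈-++⁻ (boundedRegular j n) xs∈
  ... | inj₁ xs∈₁ = boundedRegular-complete (suc j) n (boundedRegular-grow (boundedRegular-sound j n xs∈₁))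
  ... | inj₂ xs∈₂ with _ , ys∈ , refl ← ∈-map⁻ (odd j ∷_) xs∈₂ =
    boundedRegular-complete (suc j) n (boundedRegular-cons (boundedRegular-sound (suc j) d ys∈))

-- The recurrence on largest parts, with subtraction turned into addition modulo 2.
factor-count : ∀ j → factor (odd j) (count (suc j)) ≗ count j
factor-count j n with odd j ≤? n
... | no odd≰n = trans
  (factor-large (count (suc j)) (≰⇒> odd≰n) ≤-refl)
  (cong parity (length-boundedRegular-< j n (≰⇒> odd≰n)))
... | yes odd≤n = subst (λ n → factor (odd j) (count (suc j)) n ≡ count j n) (m+[n∸m]≡n odd≤n) (begin
  count (suc j) (odd j + d) ⊕ shift (odd j) (count (suc j)) (odd j + d)
    ≡⟨ cong₂ _⊕_ (cong parity (length-boundedRegular-+ j d)) (shift-≥ (odd j) (count (suc j)) d) ⟩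
  parity (length (boundedRegular j (odd j + d)) + length (boundedRegular (suc j) d)) ⊕ count (suc j) d
    ≡⟨ cong (_⊕ count (suc j) d) (ℙ.+-homo-+ (length (boundedRegular j (odd j + d))) _) ⟩
  (count j (odd j + d) ⊕ count (suc j) d) ⊕ count (suc j) d
    ≡⟨ ℙ.+-assoc (count j (odd j + d)) _ _ ⟩
  count j (odd j + d) ⊕ (count (suc j) d ⊕ count (suc j) d)
    ≡⟨ cong (count j (odd j + d) ⊕_) (ℙ.p+p≡0ℙ (count (suc j) d)) ⟩
  count j (odd j + d) ⊕ 0ℙ
    ≡⟨ ℙ.+-identityʳ _ ⟩
  count j (odd j + d) ∎)
  where
  open ≡-Reasoning
  d : ℕ
  d = n ∸ odd j

count-0 : count 0 ≗ 𝟙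
count-0 zero    = refl
count-0 (suc n) = cong parity
  (unique⇒length≡ (boundedRegular-unique 0 (suc n)) [] (⊥-elim ∘ none) (λ ()))
  where
  none : ∀ {xs} → xs ∈ boundedRegular 0 (suc n) → ⊥
  none xs∈ with boundedRegular-sound 0 (suc n) xs∈
  ... | (((_ ∷ _ , _) , _) , 2∤0 ∷ _) , z≤n ∷ _ = 2∤0 (2 ∣0)

factors-count : ∀ h → factors odd h (count h) ≗ 𝟙
factors-count zero    n = count-0 n
factors-count (suc h) n = begin
  factor (odd h) (factors odd h (count (suc h))) n
    ≡⟨ factors-factor odd h (odd h) (count (suc h)) n ⟨
  factors odd h (factor (odd h) (count (suc h))) n
    ≡⟨ factors-cong odd h (factor-count h) n ⟩
  factors odd h (count h) n
    ≡⟨ factors-count h n ⟩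
  𝟙 n ∎
  where open ≡-Reasoning

parts≤sum : ∀ xs → All (_≤ sum xs) xs
parts≤sum []       = []
parts≤sum (x ∷ xs) = m≤m+n x (sum xs) ∷ All.map (λ y≤ → ≤-trans y≤ (m≤n+m (sum xs) x)) (parts≤sum xs)

-- Every part is at most n, hence at most 2h, so the bound excludes nothing.
parity-b : ∀ {h n} → n ≤ h → parity (b 2 n) ≡ count h n
parity-b {h} {n} n≤h = cong (parity ∘ length)
  (sym (filter-all (All.all? (_≤? h + h)) (All.tabulate bounded)))
  where
  bounded : ∀ {xs} → xs ∈ filter (regular? 2) (partitions n) → All (_≤ h + h) xs
  bounded {xs} xs∈
    with ((_ , refl) , _) ← partitions-sound n (proj₁ (∈-filter⁻ (regular? 2) {xs = partitions n} xs∈))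
    = All.map (λ y≤ → ≤-trans y≤ (≤-trans n≤h (m≤m+n h h))) (parts≤sum xs)

parity≡0⇒%2≡0 : ∀ n → parity n ≡ 0ℙ → n % 2 ≡ 0
parity≡0⇒%2≡0 zero          _  = refl
parity≡0⇒%2≡0 (suc (suc n)) eq = parity≡0⇒%2≡0 n eq

b₂-nonPentagonal : ∀ n → NonPentagonal n → b 2 n % 2 ≡ 0
b₂-nonPentagonal n np = parity≡0⇒%2≡0 (b 2 n) (begin
  -- The truncation is n + 1 because the pentagonal step requires the degree to be strictly below
  -- the number of factors.
  parity (b 2 n)              ≡⟨ parity-b (n≤1+n n) ⟩
  count (suc n) n             ≡⟨ factors-odd⇒factors-suc (suc n) (λ {m} _ → factors-count (suc n) m) (n≤1+n n) ⟩
  factors suc (suc n) 𝟙 n     ≡⟨ factors-suc-nonPentagonal {suc n} {n} ≤-refl np ⟩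
  0ℙ                          ∎)
  where open ≡-Reasoning

-- Squares and primes

prime-∤ : ∀ {p} d → Prime p → 1 < d → d < p → ¬ d ∣ p
prime-∤ d pp 1<d d<p d∣p with prime⇒irreducible pp d∣p
... | inj₁ refl = <-irrefl refl 1<d
... | inj₂ refl = <-irrefl refl d<p

-- Abstract, because unfolding the decision procedure in later goals is expensive.
abstract
  square-mod-24 : ∀ {r} → r < 24 → 2 ∣ r ⊎ 3 ∣ r ⊎ r * r % 24 ≡ 1
  square-mod-24 = from-yes (allUpTo? (λ r → (2 ∣? r) ⊎-dec ((3 ∣? r) ⊎-dec (r * r % 24 ≟ 1))) 24)

-- As 2 and 3 divide 24, if either divided the residue of p it would divide p itself; a residue
-- prime to 6 squares to 1.
prime²%24≡1 : ∀ {p} → Prime p → p ≥ 5 → p ^ 2 % 24 ≡ 1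
prime²%24≡1 {p} pp p≥5 with square-mod-24 (m%n<n p 24)
... | inj₁ 2∣r = ⊥-elim (prime-∤ 2 pp (s≤s (s≤s z≤n)) (≤-trans (s≤s (s≤s (s≤s z≤n))) p≥5)
                  (∣n∣m%n⇒∣m (divides 12 refl) 2∣r))
... | inj₂ (inj₁ 3∣r) = ⊥-elim (prime-∤ 3 pp (s≤s (s≤s z≤n)) (≤-trans (s≤s (s≤s (s≤s (s≤s z≤n)))) p≥5)
                  (∣n∣m%n⇒∣m (divides 8 refl) 3∣r))
... | inj₂ (inj₂ eq) = trans (cong (λ q → p * q % 24) (*-identityʳ p)) (trans (%-distribˡ-* p p 24) eq)

∏-%≡1 : ∀ {d} .{{_ : NonZero d}} → 1 % d ≡ 1 → ∀ {k} (v : Vector ℕ k) → (∀ s → v s % d ≡ 1) → ∏ v % d ≡ 1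
∏-%≡1 1%d {zero}  v v≡1 = 1%d
∏-%≡1 {d} 1%d {suc k} v v≡1 = begin
  v Fin.zero * ∏ (v ∘ Fin.suc) % d
    ≡⟨ %-distribˡ-* (v Fin.zero) _ d ⟩
  (v Fin.zero % d) * (∏ (v ∘ Fin.suc) % d) % d
    ≡⟨ cong₂ (λ x y → x * y % d) (v≡1 Fin.zero) (∏-%≡1 1%d (v ∘ Fin.suc) (v≡1 ∘ Fin.suc)) ⟩
  1 % d ≡⟨ 1%d ⟩
  1 ∎
  where open ≡-Reasoning

∏-init-last : ∀ {k} (v : Vector ℕ (suc k)) → ∏ v ≡ ∏ (init v) * last v
∏-init-last {zero}  v = *-comm (v Fin.zero) 1
∏-init-last {suc k} v = trans (cong (v Fin.zero *_) (∏-init-last (v ∘ Fin.suc)))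
  (sym (*-assoc (v Fin.zero) _ _))

prime∣square : ∀ {p x} → Prime p → p ∣ x * x → p ∣ x
prime∣square {x = x} pp = [ id , id ]′ ∘ euclidsLemma x x pp

-- Each prime divides x, and its square is cancelled before the next prime is treated, so repeated
-- primes are covered.
square-quotient : ∀ {k} (p : Vector ℕ k) → (∀ s → Prime (p s)) → ∀ {x y} →
  x * x ≡ ∏ (map (_^ 2) p) * y → ∃ λ z → z * z ≡ y
square-quotient {zero}  p pp {x} {y} eq = x , trans eq (*-identityˡ y)
square-quotient {suc k} p pp {x} {y} eq
  with divides z refl ← prime∣square {x = x} (pp Fin.zero)
    (subst (p Fin.zero ∣_) (sym eq) (∣m⇒∣m*n y (∣m⇒∣m*n _ (m∣m*n _))))
  = square-quotient (p ∘ Fin.suc) (pp ∘ Fin.suc) {z}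
      (*-cancelˡ-≡ _ _ (q * q) (trans (lemma z q) (trans eq (lemma′ q _ y))))
  where
  q : ℕ
  q = p Fin.zero
  instance _ = m*n≢0 q q {{prime⇒nonZero (pp Fin.zero)}} {{prime⇒nonZero (pp Fin.zero)}}
  lemma : ∀ z q → q * q * (z * z) ≡ z * q * (z * q)
  lemma = solve-∀
  lemma′ : ∀ q P y → q * (q * 1) * P * y ≡ q * q * (P * y)
  lemma′ = solve-∀

prime≥5-∤24 : ∀ {q} → Prime q → q ≥ 5 → ¬ q ∣ 24
-- Size rules out a divisor of 4 but not one of 6, which is therefore split again as 2 times 3.
prime≥5-∤24 pq q≥5 q∣24 with euclidsLemma 4 6 pq q∣24
... | inj₁ q∣4 = <⇒≱ q≥5 (∣⇒≤ q∣4)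
... | inj₂ q∣6 with euclidsLemma 2 3 pq q∣6
... | inj₁ q∣2 = <⇒≱ q≥5 (≤-trans (∣⇒≤ q∣2) (s≤s (s≤s z≤n)))
... | inj₂ q∣3 = <⇒≱ q≥5 (≤-trans (∣⇒≤ q∣3) (s≤s (s≤s (s≤s z≤n))))

-- If q divides z², then q² does too, so q divides q a + c and hence c.
nonsquare : ∀ {q} → Prime q → ∀ {a c} → ¬ q ∣ c → ∀ z → z * z ≢ q * (q * a + c)
nonsquare {q} pq {a} {c} q∤c z eq
  with divides w refl ← prime∣square {x = z} pq (subst (q ∣_) (sym eq) (m∣m*n _))
  = q∤c (∣m+n∣m⇒∣n (divides (w * w) (sym w²q≡)) (m∣m*n a))
  where
  lemma : ∀ w q → q * (w * w * q) ≡ w * q * (w * q)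
  lemma = solve-∀
  w²q≡ : w * w * q ≡ q * a + c
  w²q≡ = *-cancelˡ-≡ _ _ q {{prime⇒nonZero pq}} (trans (lemma w q) eq)

theorem3p6 : (k : ℕ) (p : Vector ℕ (suc k)) →
    (∀ s → Prime (p s)) → (∀ s → p s ≥ 5) →
    (n i : ℕ) → 1 ≤ i → i ≤ last p ∸ 1 →
    b 2 (∏ (map (_^ 2) p) * n + ((24 * i + last p) * ∏ (map (_^ 2) (init p)) * last p ∸ 1) / 24) % 2 ≡ 0
-- From a square root of 24 N + 1, dividing out all primes but the last leaves a square that q
-- divides exactly once.
theorem3p6 k p prime p≥5 n i 1≤i i≤ = b₂-nonPentagonal N λ x x²≡ →
  let z , z²≡ = square-quotient (init p) (prime ∘ Fin.inject₁) {x} (trans x²≡ 24N+1≡)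
  in  nonsquare pq q∤24i z z²≡
  where
  open ≡-Reasoning
  q P X N : ℕ
  q = last p
  P = ∏ (map (_^ 2) (init p))
  X = (24 * i + q) * P * q
  N = ∏ (map (_^ 2) p) * n + (X ∸ 1) / 24

  pq : Prime q
  pq = prime (Fin.fromℕ k)

  q∤24i : ¬ q ∣ 24 * i
  q∤24i q∣24i with euclidsLemma 24 i pq q∣24i
  ... | inj₁ q∣24 = prime≥5-∤24 pq (p≥5 (Fin.fromℕ k)) q∣24
  ... | inj₂ q∣i  = <⇒≱ (≤-<-trans i≤ (∸-monoʳ-< {q} (s≤s z≤n) (≤-trans (s≤s z≤n) (p≥5 (Fin.fromℕ k)))))
                      (∣⇒≤ {{>-nonZero 1≤i}} q∣i)

  -- This makes the division by 24 in `N` exact. Up to a multiple of 24, X is the product of all the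
  -- squared primes.
  X%24≡1 : X % 24 ≡ 1
  X%24≡1 = begin
    X % 24                                  ≡⟨ cong (_% 24) (lemma i q P) ⟩
    (P * q ^ 2 + i * P * q * 24) % 24       ≡⟨ [m+kn]%n≡m%n (P * q ^ 2) (i * P * q) 24 ⟩
    P * q ^ 2 % 24                          ≡⟨ cong (_% 24) (∏-init-last (map (_^ 2) p)) ⟨
    ∏ (map (_^ 2) p) % 24                   ≡⟨ ∏-%≡1 refl (map (_^ 2) p) (λ s → prime²%24≡1 (prime s) (p≥5 s)) ⟩
    1                                       ∎
    where
    lemma : ∀ i q P → (24 * i + q) * P * q ≡ P * (q * (q * 1)) + i * P * q * 24
    lemma = solve-∀

  X≡1+Y*24 : X ≡ 1 + X / 24 * 24
  X≡1+Y*24 = trans (m≡m%n+[m/n]*n X 24) (cong (_+ X / 24 * 24) X%24≡1)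

  24N+1≡ : 24 * N + 1 ≡ P * (q * (q * (24 * n + 1) + 24 * i))
  24N+1≡ = begin
    24 * (∏ (map (_^ 2) p) * n + (X ∸ 1) / 24) + 1
      ≡⟨ cong₂ (λ u v → 24 * (u * n + v) + 1) (∏-init-last (map (_^ 2) p))
           (trans (cong (λ m → (m ∸ 1) / 24) X≡1+Y*24) (m*n/n≡m (X / 24) 24)) ⟩
    24 * (P * q ^ 2 * n + X / 24) + 1
      ≡⟨ lemma₁ P q n (X / 24) ⟩
    24 * (P * q ^ 2 * n) + (1 + X / 24 * 24)
      ≡⟨ cong (24 * (P * q ^ 2 * n) +_) X≡1+Y*24 ⟨
    24 * (P * q ^ 2 * n) + X
      ≡⟨ lemma₂ P q n i ⟩
    P * (q * (q * (24 * n + 1) + 24 * i)) ∎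
    where
    lemma₁ : ∀ P q n Y → 24 * (P * (q * (q * 1)) * n + Y) + 1 ≡ 24 * (P * (q * (q * 1)) * n) + (1 + Y * 24)
    lemma₁ = solve-∀
    lemma₂ : ∀ P q n i → 24 * (P * (q * (q * 1)) * n) + (24 * i + q) * P * q ≡ P * (q * (q * (24 * n + 1) + 24 * i))
    lemma₂ = solve-∀
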